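{- Let $k,\ell$ be positive integers. Then $$\mathcal{D}(P_k\,\square\,P_\ell,\mathcal{P})>\frac{k\ell}{8}-\frac{\max\{k,\ell\}}{8}-\min\{k,\ell\}.$$ That is, for every labeling $f$ of the edges of $P_k\,\square\,P_\ell$ by $\{ -1,1\}$ there is a path $Q$ in $P_k\,\square\,P_\ell$ with $\left|\sum_{e\in E(Q)}f(e)\right|>k\ell/8-\max\{k,\ell\}/8-\min\{k,\ell\}$.
   Context: $P_k$ is the path on $k$ vertices and $\square$ is the Cartesian product of graphs, so $P_k\,\square\,P_\ell$ is the $k\times\ell$ grid graph. For a graph $G$, a family $\mathcal{S}_G$ of subgraphs of $G$ and $f:E(G)\to\{ -1,1\}$, put $f(S)=\sum_{e\in E(S)}f(e)$ for $S\in\mathcal{S}_G$; the discrepancy is $\mathcal{D}(G,\mathcal{S}_G)=\min_f\max_{S\in\mathcal{S}_G}|f(S)|$, the minimum being over all $f:E(G)\to\{ -1,1\}$. $\mathcal{P}$ is the set of all (not necessarily spanning) paths that are subgraphs of $G$; a single vertex counts as a path. -}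

module Defs where

open import Data.Fin.Base using (Fin; toℕ)
open import Data.Integer.Base as ℤ using (ℤ; 0ℤ; _◃_; ∣_∣)
open import Data.List.Base using (List; []; _∷_; map; foldr)
open import Data.List.Membership.Propositional using (_∈_)
open import Data.List.Relation.Unary.All as All using (All; []; _∷_)
open import Data.List.Relation.Unary.AllPairs using (AllPairs; []; _∷_)
open import Data.List.Relation.Unary.Any using (here; there)
open import Data.List.Relation.Unary.Linked using (Linked; []; [-]; _∷_)
open import Data.List.Relation.Unary.Unique.Propositional using (Unique)
open import Data.Nat.Base as ℕ using (ℕ; suc; _≤_)
open import Data.Nat.Properties using (1+n≢n)
open import Data.Product.Base using (_×_; _,_; proj₁; proj₂; ∃-syntax)
open import Data.Sign.Base using (Sign)
open import Data.Sum.Base using (_⊎_; inj₁; inj₂; swap)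
open import Function.Base using (_∘_)
open import Relation.Binary.PropositionalEquality using (_≡_; _≢_; refl; sym)
open import Relation.Nullary.Negation using (¬_)

record Graph : Set₁ where
  field
    Vertex   : Set
    _~_      : Vertex → Vertex → Set
    ~-sym    : ∀ {u v} → u ~ v → v ~ u
    ~-irrefl : ∀ {v} → ¬ (v ~ v)

P : ℕ → Graph
P n = record
  { Vertex   = Fin n
  ; _~_      = λ i j → suc (toℕ i) ≡ toℕ j ⊎ suc (toℕ j) ≡ toℕ i
  ; ~-sym    = swap
  ; ~-irrefl = λ { (inj₁ e) → 1+n≢n e ; (inj₂ e) → 1+n≢n e }
  }

infixr 6 _□_

_□_ : Graph → Graph → Graph
G □ H = record
  { Vertex   = G.Vertex × H.Vertex
  ; _~_      = λ (u , v) (u′ , v′) → (u ≡ u′ × v H.~ v′) ⊎ (u G.~ u′ × v ≡ v′)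
  ; ~-sym    = λ { (inj₁ (e , a)) → inj₁ (sym e , H.~-sym a)
                 ; (inj₂ (a , e)) → inj₂ (G.~-sym a , sym e) }
  ; ~-irrefl = λ { (inj₁ (_ , a)) → H.~-irrefl a
                 ; (inj₂ (a , _)) → G.~-irrefl a }
  }
  where
  module G = Graph G
  module H = Graph H

-- An edge is presented by an orientation of it; E(G) is Edge G modulo SameEdge.
record Edge (G : Graph) : Set where
  constructor edge
  open Graph G
  field
    {src tgt} : Vertex
    adjacent  : src ~ tgt

open Edge public using (src; tgt)

SameEdge : ∀ {G} → Edge G → Edge G → Set
SameEdge e e′ = (src e ≡ src e′ × tgt e ≡ tgt e′) ⊎ (src e ≡ tgt e′ × tgt e ≡ src e′)

record Labelling (G : Graph) : Set where
  field
    label      : Edge G → Sign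
    label-cong : ∀ {e e′} → SameEdge e e′ → label e ≡ label e′

record Subgraph (G : Graph) : Set where
  open Graph G
  field
    vertices        : List Vertex
    edges           : List (Edge G)
    vertices-unique : Unique vertices
    edges-distinct  : AllPairs (λ e e′ → ¬ SameEdge e e′) edges
    endpoints       : All (λ e → src e ∈ vertices × tgt e ∈ vertices) edges

-- f(S), the sum of f(e) ∈ {-1, 1} over the edges e of S.
weight : ∀ {G} → Labelling G → Subgraph G → ℤ
weight f S = foldr ℤ._+_ 0ℤ (map (λ e → Labelling.label f e ◃ 1) (Subgraph.edges S))

record SubgraphFamily (G : Graph) : Set₁ where
  field
    Index  : Set
    member : Index → Subgraph G

module _ {G : Graph} (𝒮 : SubgraphFamily G) where
  open SubgraphFamily 𝒮

  -- m = max over S ∈ 𝒮 of |f(S)|.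
  IsMaxWeight : Labelling G → ℕ → Set
  IsMaxWeight f m =
    (∃[ i ] ∣ weight f (member i) ∣ ≡ m) × (∀ i → ∣ weight f (member i) ∣ ≤ m)

  -- d = 𝒟(G, 𝒮), the least of these maxima over all labellings f.
  IsDiscrepancy : ℕ → Set
  IsDiscrepancy d =
    (∃[ f ] IsMaxWeight f d) × (∀ f m → IsMaxWeight f m → d ≤ m)

record Path (G : Graph) : Set where
  open Graph G
  field
    start    : Vertex
    rest     : List Vertex
    linked   : Linked _~_ (start ∷ rest)
    distinct : Unique (start ∷ rest)

module _ {G : Graph} where
  open Graph G

  linkEdges : ∀ {vs} → Linked _~_ vs → List (Edge G)
  linkEdges []      = []
  linkEdges [-]     = []
  linkEdges (a ∷ l) = edge a ∷ linkEdges l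

  linkEdges-endpoints : ∀ {vs} (l : Linked _~_ vs) →
    All (λ e → src e ∈ vs × tgt e ∈ vs) (linkEdges l)
  linkEdges-endpoints []      = []
  linkEdges-endpoints [-]     = []
  linkEdges-endpoints (a ∷ l) =
    (here refl , there (here refl)) ∷
    All.map (λ (s , t) → there s , there t) (linkEdges-endpoints l)

  linkEdges-distinct : ∀ {vs} (l : Linked _~_ vs) → Unique vs →
    AllPairs (λ e e′ → ¬ SameEdge e e′) (linkEdges l)
  linkEdges-distinct []      _        = []
  linkEdges-distinct [-]     _        = []
  linkEdges-distinct (a ∷ l) (x∉ ∷ u) =
    All.map (λ { (s , t) (inj₁ (p , _)) → All.lookup x∉ s p
               ; (s , t) (inj₂ (p , _)) → All.lookup x∉ t p })
            (linkEdges-endpoints l)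
    ∷ linkEdges-distinct l u

  pathSubgraph : Path G → Subgraph G
  pathSubgraph Q = record
    { vertices        = start ∷ rest
    ; edges           = linkEdges linked
    ; vertices-unique = distinct
    ; edges-distinct  = linkEdges-distinct linked distinct
    ; endpoints       = linkEdges-endpoints linked
    }
    where open Path Q

-- A path subgraph occurs once per traversal direction; this does not affect maxima.
𝒫 : (G : Graph) → SubgraphFamily G
𝒫 G = record { Index = Path G ; member = pathSubgraph }

{-# OPTIONS --safe #-}

-- Around a 4-cycle p q r s with edge signs α = pq, β = ps, γ = sr, δ = rq, the two routes p q and
-- p s r q differ in weight by α − (β + γ + δ), the two routes p q r and p s r by (α + δ) − (β + γ).
-- One of these is ±2 according to the sign of αβγδ, so whatever the labels, a path entering a unit
-- square at p can leave it on the opposite side in two ways whose weights differ by at least 2.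
-- By symmetry let k ≥ ℓ. A path traversing a two-row ladder of length k passes through ⌊(k − 1)/2⌋
-- such squares, the last column being kept free to choose the exit row, and a boustrophedon path
-- traverses ⌊ℓ/2⌋ ladders. Taking the heavier way everywhere, or the lighter one, gives paths whose
-- weights differ by at least 2⌊ℓ/2⌋⌊(k − 1)/2⌋; one of them has at least half of this as absolute
-- weight.
module Submission where

open import Defs
open import Data.Integer.Base using (+_; ∣_∣)
open import Data.Nat.Base using (ℕ; NonZero; _*_; _⊔_; _⊓_)
open import Data.Product.Base using (_×_; ∃-syntax)
open import Data.Rational.Base using (_/_; _-_; _<_)

open import Data.Fin.Base using (Fin; zero; suc; toℕ; fromℕ; opposite; _↑ˡ_; _↑ʳ_)
import Data.Fin.Properties as Fin
open import Data.Integer.Base as ℤ using (ℤ; 0ℤ; _◃_)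
import Data.Integer.Properties as ℤ
open import Data.Integer.Tactic.RingSolver using () renaming (solve-∀ to solveℤ-∀)
open import Data.List.Base using (List; []; _∷_; _++_; map)
open import Data.List.Membership.Propositional using (_∈_)
open import Data.List.Membership.Propositional.Properties using (∈-map⁻)
open import Data.List.Relation.Unary.All using ([]; _∷_)
open import Data.List.Relation.Unary.AllPairs using ([]; _∷_)
open import Data.List.Relation.Unary.Linked using (Linked; [-]; _∷_)
open import Data.List.Relation.Unary.Unique.Propositional using (Unique)
import Data.List.Relation.Unary.Unique.Propositional.Properties as Unique
open import Data.Nat.Base as ℕ using (zero; suc; _+_; _≤_; z≤n; s≤s; ⌊_/2⌋)
import Data.Nat.Properties as ℕ
open import Data.Nat.Tactic.RingSolver using (solve-∀)
open import Data.Product.Base using (_,_; proj₁; proj₂; ∃; swap)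
import Data.Rational.Base as ℚ
import Data.Rational.Properties as ℚ
import Data.Rational.Unnormalised.Base as ℚᵘ
import Data.Rational.Unnormalised.Properties as ℚᵘ
open import Data.Sign.Base as Sign using ()
open import Data.Sum.Base as Sum using (_⊎_; inj₁; inj₂)
open import Function.Base using (_∘_; id)
open import Relation.Binary.Construct.Closure.ReflexiveTransitive
  using (Star; ε; _◅_; _◅◅_; gmap)
open import Relation.Binary.PropositionalEquality
  using (_≡_; _≢_; refl; sym; trans; cong; cong₂; subst; module ≡-Reasoning)

open Labelling using (label; label-cong)

-- Embeddings of graphs and pulled-back labellings

record Embedding (G H : Graph) : Set where
  private
    module G = Graph G
    module H = Graph H
  field
    to        : G.Vertex → H.Vertex
    adjacent  : ∀ {u v} → u G.~ v → to u H.~ to v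
    injective : ∀ {u v} → to u ≡ to v → u ≡ v

open Embedding using (to)

-- A block of the grid, seen as the image of a standard smaller grid, passes its labels back this
-- way, so that forks can be built in the smaller grid and then transported.
pullback : ∀ {G H} → Embedding G H → Labelling H → Labelling G
pullback {G} {H} φ f = record
  { label      = λ e → label f (push e)
  ; label-cong = λ s → label-cong f
      (Sum.map (λ (p , q) → cong (to φ) p , cong (to φ) q)
               (λ (p , q) → cong (to φ) p , cong (to φ) q) s)
  }
  where
  push : Edge G → Edge H
  push e = edge (Embedding.adjacent φ (Edge.adjacent e))

+≤⇒≤∣∣ : ∀ {m i} → + m ℤ.≤ i → m ≤ ∣ i ∣
+≤⇒≤∣∣ (ℤ.+≤+ m≤n) = m≤n

-- Walks, forks and the heavy path a fork yields

module _ {G : Graph} where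
  open Graph G

  -- `Star` keeps both endpoints in the type, as gluing requires; `Path` exposes only its start.
  Walk : Vertex → Vertex → Set
  Walk = Star _~_

  later : ∀ {u v} → Walk u v → List Vertex
  later ε                 = []
  later (_◅_ {j = w} _ p) = w ∷ later p

  vertices : ∀ {u v} → Walk u v → List Vertex
  vertices {u} p = u ∷ later p

  edgeWeight : Labelling G → ∀ {u v} → u ~ v → ℤ
  edgeWeight f a = label f (edge a) ◃ 1

  walkWeight : Labelling G → ∀ {u v} → Walk u v → ℤ
  walkWeight f ε       = 0ℤ
  walkWeight f (a ◅ p) = edgeWeight f a ℤ.+ walkWeight f p

  vertices-◅◅ : ∀ {t u v w} (p : Walk t u) (a : u ~ v) (q : Walk v w) →
    vertices (p ◅◅ a ◅ q) ≡ vertices p ++ vertices q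
  vertices-◅◅ ε       a q = refl
  vertices-◅◅ {t} (b ◅ p) a q = cong (t ∷_) (vertices-◅◅ p a q)

  walkWeight-◅◅ : ∀ f {t u v w} (p : Walk t u) (a : u ~ v) (q : Walk v w) →
    walkWeight f (p ◅◅ a ◅ q) ≡ walkWeight f p ℤ.+ (edgeWeight f a ℤ.+ walkWeight f q)
  walkWeight-◅◅ f ε       a q = sym (ℤ.+-identityˡ _)
  walkWeight-◅◅ f (b ◅ p) a q =
    trans (cong (λ x → edgeWeight f b ℤ.+ x) (walkWeight-◅◅ f p a q)) (sym (ℤ.+-assoc (edgeWeight f b) _ _))

  linked : ∀ {u v} (p : Walk u v) → Linked _~_ (vertices p)
  linked ε       = [-]
  linked (a ◅ p) = a ∷ linked p

  toPath : ∀ {u v} (p : Walk u v) → Unique (vertices p) → Path G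
  toPath {u} p distinct = record
    { start = u ; rest = later p ; linked = linked p ; distinct = distinct }

  weight-toPath : ∀ f {u v} (p : Walk u v) distinct →
    weight f (pathSubgraph (toPath p distinct)) ≡ walkWeight f p
  weight-toPath f ε       _              = refl
  weight-toPath f (a ◅ p) (_ ∷ distinct) =
    cong (λ x → edgeWeight f a ℤ.+ x) (weight-toPath f p distinct)

  -- Because the endpoints are common, successive forks can be glued upper to upper and lower to
  -- lower, and the gaps add up. The unit of `s` is 2, the gain guaranteed by one square.
  record Fork (f : Labelling G) (u v : Vertex) (s : ℕ) : Set where
    field
      upper lower    : Walk u v
      upper-distinct : Unique (vertices upper)
      lower-distinct : Unique (vertices lower)
      gap            : + (2 * s) ℤ.≤ walkWeight f upper ℤ.- walkWeight f lower

  open Fork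

  trivialFork : ∀ {f u v} (p : Walk u v) → Unique (vertices p) → Fork f u v 0
  trivialFork {f} p distinct = record
    { upper = p ; lower = p ; upper-distinct = distinct ; lower-distinct = distinct
    ; gap = ℤ.≤-reflexive (sym (ℤ.+-inverseʳ (walkWeight f p))) }

  fork : ∀ {f u v s} (p q : Walk u v) → Unique (vertices p) → Unique (vertices q) →
    2 * s ≤ ∣ walkWeight f p ℤ.- walkWeight f q ∣ → Fork f u v s
  fork {f} p q p! q! 2s≤
    with ℤ.+∣i∣≡i⊎+∣i∣≡-i (walkWeight f p ℤ.- walkWeight f q)
  ... | inj₁ ∣d∣≡d  = record
    { upper = p ; lower = q ; upper-distinct = p! ; lower-distinct = q!
    ; gap = subst (+ _ ℤ.≤_) ∣d∣≡d (ℤ.+≤+ 2s≤) }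
  ... | inj₂ ∣d∣≡-d = record
    { upper = q ; lower = p ; upper-distinct = q! ; lower-distinct = p!
    ; gap = subst (+ _ ℤ.≤_) (trans ∣d∣≡-d (negate (walkWeight f p) (walkWeight f q))) (ℤ.+≤+ 2s≤) }
    where
    negate : ∀ x y → ℤ.- (x ℤ.- y) ≡ y ℤ.- x
    negate = solveℤ-∀

  HasPath : Labelling G → ℕ → Set
  HasPath f s =
    ∃[ u ] ∃[ v ] ∃ λ (p : Walk u v) → Unique (vertices p) × s ≤ ∣ walkWeight f p ∣

  hasPath⇒path : ∀ {f s} → HasPath f s → ∃[ Q ] s ≤ ∣ weight f (pathSubgraph {G} Q) ∣
  hasPath⇒path {f} {s} (_ , _ , p , distinct , s≤) =
    toPath p distinct , subst (λ w → s ≤ ∣ w ∣) (sym (weight-toPath f p distinct)) s≤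

  -- If `lower` has absolute weight at most `s`, the triangle inequality leaves at least `2 * s`
  -- minus `s` for `upper`.
  fork⇒hasPath : ∀ {f u v s} → Fork f u v s → HasPath f s
  fork⇒hasPath {f} {s = s} F with ℕ.≤-total s ∣ walkWeight f (lower F) ∣
  ... | inj₁ s≤y = _ , _ , lower F , lower-distinct F , s≤y
  ... | inj₂ y≤s = _ , _ , upper F , upper-distinct F ,
    ℕ.+-cancelʳ-≤ s s ∣ x ∣ (begin
      s + s             ≡⟨ cong (λ z → s + z) (ℕ.+-identityʳ s) ⟨
      2 * s             ≤⟨ +≤⇒≤∣∣ (gap F) ⟩
      ∣ x ℤ.- y ∣       ≤⟨ ℤ.∣i-j∣≤∣i∣+∣j∣ x y ⟩
      ∣ x ∣ + ∣ y ∣     ≤⟨ ℕ.+-monoʳ-≤ ∣ x ∣ y≤s ⟩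
      ∣ x ∣ + s         ∎)
    where
    open ℕ.≤-Reasoning
    x = walkWeight f (upper F)
    y = walkWeight f (lower F)

-- Transport and gluing along embeddings

module _ {G H : Graph} (φ : Embedding G H) where

  push : ∀ {u v} → Walk {G} u v → Walk {H} (to φ u) (to φ v)
  push = gmap (to φ) (Embedding.adjacent φ)

  vertices-push : ∀ {u v} (p : Walk {G} u v) → vertices {H} (push p) ≡ map (to φ) (vertices {G} p)
  vertices-push ε       = refl
  vertices-push {u} (a ◅ p) = cong (to φ u ∷_) (vertices-push p)

  push-distinct : ∀ {u v} (p : Walk {G} u v) → Unique (vertices {G} p) → Unique (vertices {H} (push p))
  push-distinct p distinct =
    subst Unique (sym (vertices-push p)) (Unique.map⁺ (Embedding.injective φ) distinct)

  walkWeight-push : ∀ f {u v} (p : Walk {G} u v) →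
    walkWeight {H} f (push p) ≡ walkWeight {G} (pullback φ f) p
  walkWeight-push f ε       = refl
  walkWeight-push f (a ◅ p) = cong (λ x → edgeWeight {G} (pullback φ f) a ℤ.+ x) (walkWeight-push f p)

  push-hasPath : ∀ {f s} → HasPath {G} (pullback φ f) s → HasPath {H} f s
  push-hasPath {f} {s} (_ , _ , p , distinct , s≤) =
    _ , _ , push p , push-distinct p distinct ,
    subst (λ w → s ≤ ∣ w ∣) (sym (walkWeight-push f p)) s≤

module _ {G₁ G₂ H : Graph} (φ : Embedding G₁ H) (ψ : Embedding G₂ H)
         (disjoint : ∀ x y → to φ x ≢ to ψ y) (f : Labelling H) where

  -- The connecting edge `a` lies on both glued walks and cancels in the gap. Disjointness of the
  -- two images keeps the glued vertex lists free of repetitions.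
  join : ∀ {u v u′ v′ s t} → Fork {G₁} (pullback φ f) u v s → Graph._~_ H (to φ v) (to ψ u′) →
    Fork {G₂} (pullback ψ f) u′ v′ t → Fork {H} f (to φ u) (to ψ v′) (s + t)
  join {u} {v} {u′} {v′} {s} {t} F a F′ = record
    { upper          = concat F.upper F′.upper
    ; lower          = concat F.lower F′.lower
    ; upper-distinct = concat-distinct F.upper F′.upper F.upper-distinct F′.upper-distinct
    ; lower-distinct = concat-distinct F.lower F′.lower F.lower-distinct F′.lower-distinct
    ; gap            = begin
        + (2 * (s + t))             ≡⟨ cong +_ (ℕ.*-distribˡ-+ 2 s t) ⟩
        + (2 * s) ℤ.+ + (2 * t)     ≤⟨ ℤ.+-mono-≤ F.gap F′.gap ⟩
        (weight₁ F.upper ℤ.- weight₁ F.lower) ℤ.+ (weight₂ F′.upper ℤ.- weight₂ F′.lower)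
          ≡⟨ rearrange (weight₁ F.upper) (weight₁ F.lower) (weight₂ F′.upper) (weight₂ F′.lower)
                       (edgeWeight {H} f a) ⟩
        concatWeight F.upper F′.upper ℤ.- concatWeight F.lower F′.lower
          ≡⟨ cong₂ ℤ._-_ (concat-weight F.upper F′.upper) (concat-weight F.lower F′.lower) ⟨
        walkWeight {H} f (concat F.upper F′.upper) ℤ.- walkWeight {H} f (concat F.lower F′.lower) ∎
    }
    where
    open ℤ.≤-Reasoning
    module F = Fork F
    module F′ = Fork F′

    weight₁ : Walk {G₁} u v → ℤ
    weight₁ = walkWeight {G₁} (pullback φ f)

    weight₂ : Walk {G₂} u′ v′ → ℤ
    weight₂ = walkWeight {G₂} (pullback ψ f)

    concat : Walk {G₁} u v → Walk {G₂} u′ v′ → Walk {H} (to φ u) (to ψ v′)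
    concat p q = push φ p ◅◅ a ◅ push ψ q

    concatWeight : Walk {G₁} u v → Walk {G₂} u′ v′ → ℤ
    concatWeight p q = weight₁ p ℤ.+ (edgeWeight {H} f a ℤ.+ weight₂ q)

    concat-weight : ∀ p q → walkWeight {H} f (concat p q) ≡ concatWeight p q
    concat-weight p q = trans (walkWeight-◅◅ {H} f (push φ p) a (push ψ q))
      (cong₂ (λ x y → x ℤ.+ (edgeWeight {H} f a ℤ.+ y)) (walkWeight-push φ f p) (walkWeight-push ψ f q))

    concat-distinct : ∀ p q → Unique (vertices {G₁} p) → Unique (vertices {G₂} q) →
      Unique (vertices {H} (concat p q))
    concat-distinct p q p! q! = subst Unique (sym (vertices-◅◅ {H} (push φ p) a (push ψ q)))
      (Unique.++⁺ (push-distinct φ p p!) (push-distinct ψ q q!)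
        λ {x} (x∈p , x∈q) →
          let (y , _ , x≡φy) = ∈-map⁻ (to φ) (subst (x ∈_) (vertices-push φ p) x∈p)
              (z , _ , x≡ψz) = ∈-map⁻ (to ψ) (subst (x ∈_) (vertices-push ψ q) x∈q)
          in disjoint y z (trans (sym x≡φy) x≡ψz))

    rearrange : ∀ x y x′ y′ e →
      (x ℤ.- y) ℤ.+ (x′ ℤ.- y′) ≡ (x ℤ.+ (e ℤ.+ x′)) ℤ.- (y ℤ.+ (e ℤ.+ y′))
    rearrange = solveℤ-∀

-- Embeddings between path graphs and between grids

module _ {G H G′ H′ : Graph} where

  _⊠_ : Embedding G G′ → Embedding H H′ → Embedding (G □ H) (G′ □ H′)
  φ ⊠ ψ = record
    { to        = λ (u , v) → to φ u , to ψ v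
    ; adjacent  = λ { (inj₁ (p , a)) → inj₁ (cong (to φ) p , Embedding.adjacent ψ a)
                    ; (inj₂ (a , p)) → inj₂ (Embedding.adjacent φ a , cong (to ψ) p) }
    ; injective = λ e → cong₂ _,_ (Embedding.injective φ (cong proj₁ e))
                                  (Embedding.injective ψ (cong proj₂ e))
    }

transpose : ∀ {G H} → Embedding (G □ H) (H □ G)
transpose = record
  { to        = swap
  ; adjacent  = λ { (inj₁ (p , a)) → inj₂ (a , p) ; (inj₂ (a , p)) → inj₁ (p , a) }
  ; injective = λ { refl → refl }
  }

identity : ∀ {G} → Embedding G G
identity = record { to = id ; adjacent = id ; injective = id }

initial : ∀ m n → Embedding (P m) (P (m + n))
initial m n = record
  { to        = _↑ˡ n
  ; adjacent  = λ {i} {j} → Sum.map (shift i j) (shift j i)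
  ; injective = Fin.↑ˡ-injective n _ _
  }
  where
  shift : ∀ i j → suc (toℕ i) ≡ toℕ j → suc (toℕ (i ↑ˡ n)) ≡ toℕ (j ↑ˡ n)
  shift i j e = trans (cong suc (Fin.toℕ-↑ˡ i n)) (trans e (sym (Fin.toℕ-↑ˡ j n)))

final : ∀ m n → Embedding (P n) (P (m + n))
final m n = record
  { to        = m ↑ʳ_
  ; adjacent  = λ {i} {j} → Sum.map (shift i j) (shift j i)
  ; injective = Fin.↑ʳ-injective m _ _
  }
  where
  shift : ∀ i j → suc (toℕ i) ≡ toℕ j → suc (toℕ (m ↑ʳ i)) ≡ toℕ (m ↑ʳ j)
  shift i j e = trans (cong suc (Fin.toℕ-↑ʳ m i))
    (trans (sym (ℕ.+-suc m (toℕ i))) (trans (cong (λ x → m + x) e) (sym (Fin.toℕ-↑ʳ m j))))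

initial≢final : ∀ {m n} (i : Fin m) (j : Fin n) → i ↑ˡ n ≢ m ↑ʳ j
initial≢final {m} {n} i j e =
  ℕ.<⇒≢ (ℕ.<-≤-trans (Fin.toℕ<n i) (ℕ.m≤m+n m (toℕ j)))
    (trans (sym (Fin.toℕ-↑ˡ i n)) (trans (cong toℕ e) (Fin.toℕ-↑ʳ m j)))

initial~final : ∀ m n → Graph._~_ (P (suc m + suc n)) (fromℕ m ↑ˡ suc n) (suc m ↑ʳ zero)
initial~final m n = inj₁ (cong suc (trans (Fin.toℕ-↑ˡ (fromℕ m) (suc n))
  (trans (Fin.toℕ-fromℕ m) (sym (trans (Fin.toℕ-↑ʳ m zero) (ℕ.+-identityʳ m))))))

reflection : ∀ n → Embedding (P n) (P n)
reflection n = record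
  { to        = opposite
  ; adjacent  = λ {i} {j} → Sum.map (reverse i j) (reverse j i) ∘ Sum.swap
  ; injective = λ {i} {j} e →
      trans (sym (Fin.opposite-involutive i)) (trans (cong opposite e) (Fin.opposite-involutive j))
  }
  where
  reverse : ∀ i j → suc (toℕ j) ≡ toℕ i → suc (toℕ (opposite i)) ≡ toℕ (opposite j)
  reverse i j e = begin
    suc (toℕ (opposite i))     ≡⟨ cong suc (Fin.opposite-prop i) ⟩
    suc (n ℕ.∸ suc (toℕ i))    ≡⟨ ℕ.+-∸-assoc 1 (Fin.toℕ<n i) ⟨
    n ℕ.∸ toℕ i                ≡⟨ cong (n ℕ.∸_) e ⟨
    n ℕ.∸ suc (toℕ j)          ≡⟨ Fin.opposite-prop j ⟨
    toℕ (opposite j)           ∎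
    where open ≡-Reasoning

-- Forks in a unit square

-- A sum of four signs is ±2 exactly when their product is -1. For the two differences these
-- products are -αβγδ and αβγδ, so one of them is -1. The table also takes the first alternative
-- where the first difference is ±4. The trailing `0ℤ` matches the unfolding of `walkWeight`.
routesDiffer : ∀ α β γ δ →
    2 ≤ ∣ ((α ◃ 1) ℤ.+ 0ℤ) ℤ.- ((β ◃ 1) ℤ.+ ((γ ◃ 1) ℤ.+ ((δ ◃ 1) ℤ.+ 0ℤ))) ∣
  ⊎ 2 ≤ ∣ ((α ◃ 1) ℤ.+ ((δ ◃ 1) ℤ.+ 0ℤ)) ℤ.- ((β ◃ 1) ℤ.+ ((γ ◃ 1) ℤ.+ 0ℤ)) ∣
routesDiffer Sign.+ Sign.+ Sign.+ Sign.+ = inj₁ (s≤s (s≤s z≤n))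
routesDiffer Sign.+ Sign.+ Sign.+ Sign.- = inj₂ (s≤s (s≤s z≤n))
routesDiffer Sign.+ Sign.+ Sign.- Sign.+ = inj₂ (s≤s (s≤s z≤n))
routesDiffer Sign.+ Sign.+ Sign.- Sign.- = inj₁ (s≤s (s≤s z≤n))
routesDiffer Sign.+ Sign.- Sign.+ Sign.+ = inj₂ (s≤s (s≤s z≤n))
routesDiffer Sign.+ Sign.- Sign.+ Sign.- = inj₁ (s≤s (s≤s z≤n))
routesDiffer Sign.+ Sign.- Sign.- Sign.+ = inj₁ (s≤s (s≤s z≤n))
routesDiffer Sign.+ Sign.- Sign.- Sign.- = inj₁ (s≤s (s≤s z≤n))
routesDiffer Sign.- Sign.+ Sign.+ Sign.+ = inj₁ (s≤s (s≤s z≤n))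
routesDiffer Sign.- Sign.+ Sign.+ Sign.- = inj₁ (s≤s (s≤s z≤n))
routesDiffer Sign.- Sign.+ Sign.- Sign.+ = inj₁ (s≤s (s≤s z≤n))
routesDiffer Sign.- Sign.+ Sign.- Sign.- = inj₂ (s≤s (s≤s z≤n))
routesDiffer Sign.- Sign.- Sign.+ Sign.+ = inj₁ (s≤s (s≤s z≤n))
routesDiffer Sign.- Sign.- Sign.+ Sign.- = inj₂ (s≤s (s≤s z≤n))
routesDiffer Sign.- Sign.- Sign.- Sign.+ = inj₂ (s≤s (s≤s z≤n))
routesDiffer Sign.- Sign.- Sign.- Sign.- = inj₁ (s≤s (s≤s z≤n))

module _ {G : Graph} (f : Labelling G) where
  open Graph G

  cycleFork : ∀ {p q r s} → p ~ q → p ~ s → s ~ r → r ~ q → Unique (p ∷ s ∷ r ∷ q ∷ []) →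
    Fork f p q 1 ⊎ Fork f p r 1
  cycleFork pq ps sr rq
    distinct@((p≢s ∷ p≢r ∷ p≢q ∷ []) ∷ (s≢r ∷ s≢q ∷ []) ∷ (r≢q ∷ []) ∷ [] ∷ []) =
    Sum.map
      (fork (pq ◅ ε) (ps ◅ sr ◅ rq ◅ ε) ((p≢q ∷ []) ∷ [] ∷ []) distinct)
      (fork (pq ◅ ~-sym rq ◅ ε) (ps ◅ sr ◅ ε)
        ((p≢q ∷ p≢r ∷ []) ∷ (r≢q ∘ sym ∷ []) ∷ [] ∷ []) ((p≢s ∷ p≢r ∷ []) ∷ (s≢r ∷ []) ∷ [] ∷ [])
       -- The route p q r crosses the edge `rq` backwards; both orientations carry the same label.
       ∘ subst (λ δ → 2 ≤ ∣ ((α ◃ 1) ℤ.+ ((δ ◃ 1) ℤ.+ 0ℤ)) ℤ.- ((β ◃ 1) ℤ.+ ((γ ◃ 1) ℤ.+ 0ℤ)) ∣)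
               (label-cong f (inj₂ (refl , refl))))
      (routesDiffer α β γ (label f (edge rq)))
    where
    α = label f (edge pq)
    β = label f (edge ps)
    γ = label f (edge sr)

~-opposite₂ : ∀ a → Graph._~_ (P 2) a (opposite a)
~-opposite₂ zero       = inj₁ refl
~-opposite₂ (suc zero) = inj₂ refl

-- The first coordinate is the column, the second the row. In the 4-cycle, `p` and `s` form the
-- entry column, `q` and `r` the exit column, so either outcome of `cycleFork` ends in the exit
-- column; the labels decide in which row.
squareFork : ∀ (f : Labelling (P 2 □ P 2)) a →
  ∃[ x ] Fork {P 2 □ P 2} f (zero , a) (suc zero , x) 1
squareFork f a = Sum.[ (a ,_) , (opposite a ,_) ]′
  (cycleFork {P 2 □ P 2} f {zero , a} {suc zero , a} {suc zero , opposite a} {zero , opposite a}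
    (inj₂ (inj₁ refl , refl)) (inj₁ (refl , ~-opposite₂ a))
    (inj₂ (inj₁ refl , refl)) (inj₁ (refl , Graph.~-sym (P 2) {a} {opposite a} (~-opposite₂ a)))
    ((a≢ ∘ cong proj₂ ∷ (λ ()) ∷ (λ ()) ∷ []) ∷ ((λ ()) ∷ (λ ()) ∷ []) ∷
     (a≢ ∘ sym ∘ cong proj₂ ∷ []) ∷ [] ∷ []))
  where
  a≢ : a ≢ opposite a
  a≢ e = Graph.~-irrefl (P 2) {a} (subst (Graph._~_ (P 2) a) (sym e) (~-opposite₂ a))

-- A column that gains nothing but allows any exit row, which compensates for squares whose exit row
-- is forced.
columnFork : ∀ (f : Labelling (P 1 □ P 2)) a b → Fork {P 1 □ P 2} f (zero , a) (zero , b) 0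
columnFork f zero       zero       = trivialFork ε ([] ∷ [])
columnFork f zero       (suc zero) =
  trivialFork (inj₁ (refl , inj₁ refl) ◅ ε) (((λ ()) ∷ []) ∷ [] ∷ [])
columnFork f (suc zero) zero       =
  trivialFork (inj₁ (refl , inj₂ refl) ◅ ε) (((λ ()) ∷ []) ∷ [] ∷ [])
columnFork f (suc zero) (suc zero) = trivialFork ε ([] ∷ [])

-- Ladders and boustrophedon paths

beside : ∀ {H m n} (f : Labelling (P (suc m + suc n) □ H)) {i j v w x s t} →
  Fork {P (suc m) □ H} (pullback (initial (suc m) (suc n) ⊠ identity) f) (i , v) (fromℕ m , w) s →
  Fork {P (suc n) □ H} (pullback (final (suc m) (suc n) ⊠ identity) f) (zero , w) (j , x) t →
  Fork {P (suc m + suc n) □ H} f (i ↑ˡ suc n , v) (suc m ↑ʳ j , x) (s + t)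
beside {H} {m} {n} f F F′ =
  join (initial (suc m) (suc n) ⊠ identity) (final (suc m) (suc n) ⊠ identity)
    (λ (i , _) (j , _) → initial≢final i j ∘ cong proj₁) f F (inj₂ (initial~final m n , refl)) F′

-- Each square uses two columns and dictates the row in which the next block is entered, so the
-- induction needs `a` arbitrary. The exit row `b` is adjusted in the last of the `suc n` columns,
-- which leaves `n` columns for squares.
ladderFork : ∀ n (f : Labelling (P (suc n) □ P 2)) a b →
  Fork {P (suc n) □ P 2} f (zero , a) (fromℕ n , b) ⌊ n /2⌋
ladderFork zero          f a b = columnFork f a b
-- A square on the last two columns would force the exit row; the path instead goes straight across
-- and changes row only in the last column.
ladderFork (suc zero)    f a b =
  beside {P 2} {0} {0} f (columnFork _ a a) (columnFork _ a b)
ladderFork (suc (suc n)) f a b =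
  let (x , F) = squareFork _ a in
  beside {P 2} {1} {n} f F (ladderFork n _ x b)

-- The ladders run along the first coordinate and are stacked along the second. The end vertex is
-- left existential, since its side depends on the number of ladders.
snakeFork : ∀ n m (f : Labelling (P (suc n) □ P (suc m))) →
  ∃[ v ] Fork {P (suc n) □ P (suc m)} f (zero , zero) v (⌊ suc m /2⌋ * ⌊ n /2⌋)
-- A leftover single row contains no ladder, and a one-vertex path suffices for gap 0.
snakeFork n zero          f = _ , trivialFork ε ([] ∷ [])
snakeFork n (suc zero)    f =
  _ , subst (Fork f _ _) (sym (ℕ.*-identityˡ ⌊ n /2⌋)) (ladderFork n f zero (suc zero))
snakeFork n (suc (suc m)) f =
  let (_ , F) = snakeFork n m _ in
  -- The first ladder ends in the last column of its second row. Reflecting the remaining rows moves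
  -- the start of their path to that column: `opposite zero` computes to `fromℕ n`, so the
  -- connecting edge needs only `refl` there.
  _ , join (identity ⊠ initial 2 (suc m)) (reflection (suc n) ⊠ final 2 (suc m))
        (λ (_ , i) (_ , j) → initial≢final i j ∘ cong proj₂) f
        (ladderFork n _ zero (suc zero)) (inj₁ (refl , initial~final 1 m)) F

-- Arithmetic of the bound

nm<n+8m+8s : ∀ n m → let s = ⌊ suc m /2⌋ * ⌊ n /2⌋ in
  suc n * suc m ℕ.< suc n + 8 * suc m + 8 * s
nm<n+8m+8s n m = begin-strict
  suc n * suc m                      ≤⟨ ℕ.*-monoʳ-≤ (suc n) (n≤1+2⌊n/2⌋ (suc m)) ⟩
  suc n * (1 + 2 * h)                ≡⟨ expand (suc n) h ⟩
  suc n + 2 * h * suc n              ≤⟨ ℕ.+-monoʳ-≤ (suc n) (ℕ.*-monoʳ-≤ (2 * h) (s≤s (n≤1+2⌊n/2⌋ n))) ⟩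
  suc n + 2 * h * (2 + 2 * g)        ≡⟨ regroup (suc n) h g ⟩
  -- Both constants 4 are relaxed to 8 to meet the stated bound; strictness comes from the middle
  -- term, as `suc m` is positive.
  suc n + 4 * h + 4 * (h * g)        <⟨ ℕ.+-mono-<-≤ (ℕ.+-monoʳ-< (suc n) 4h<8m)
                                          (ℕ.*-monoˡ-≤ (h * g) {4} {8} (ℕ.m≤m+n 4 4)) ⟩
  suc n + 8 * suc m + 8 * (h * g)    ∎
  where
  open ℕ.≤-Reasoning
  h = ⌊ suc m /2⌋
  g = ⌊ n /2⌋

  n≤1+2⌊n/2⌋ : ∀ n → n ≤ 1 + 2 * ⌊ n /2⌋
  n≤1+2⌊n/2⌋ zero          = z≤n
  n≤1+2⌊n/2⌋ (suc zero)    = s≤s z≤n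
  n≤1+2⌊n/2⌋ (suc (suc n)) =
    ℕ.≤-trans (s≤s (s≤s (n≤1+2⌊n/2⌋ n))) (ℕ.≤-reflexive (double-suc ⌊ n /2⌋))
    where
    double-suc : ∀ x → 3 + 2 * x ≡ 1 + 2 * (1 + x)
    double-suc = solve-∀

  4h<8m : 4 * h ℕ.< 8 * suc m
  4h<8m = ℕ.≤-<-trans (ℕ.*-monoʳ-≤ 4 (ℕ.⌊n/2⌋≤n (suc m)))
                      (ℕ.*-monoˡ-< (suc m) {4} {8} (ℕ.m≤m+n 5 3))

  expand : ∀ n h → n * (1 + 2 * h) ≡ n + 2 * h * n
  expand = solve-∀

  regroup : ∀ n h g → n + 2 * h * (2 + 2 * g) ≡ n + 4 * h + 4 * (h * g)
  regroup = solve-∀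

-- Rational subtraction normalises its result, so the comparison is moved to unnormalised fractions
-- and cross-multiplied there.
a/8-b/8-c<w : ∀ a b c w → a ℕ.< b + 8 * c + 8 * w →
  (+ a) / 8 - (+ b) / 8 - (+ c) / 1 < (+ w) / 1
a/8-b/8-c<w a b c w a< = ℚ.toℚᵘ-cancel-<
  (ℚᵘ.<-respˡ-≃ (ℚᵘ.≃-sym toℚᵘ-lhs) (ℚᵘ.<-respʳ-≃ (ℚᵘ.≃-sym (toℚᵘ-/ w 0)) (ℚᵘ.*<* numerators)))
  where
  toℚᵘ-/ : ∀ n d → ℚ.toℚᵘ (ℚ.fromℚᵘ (ℚᵘ.mkℚᵘ (+ n) d)) ℚᵘ.≃ ℚᵘ.mkℚᵘ (+ n) d
  toℚᵘ-/ n d = ℚ.toℚᵘ-fromℚᵘ (ℚᵘ.mkℚᵘ (+ n) d)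

  toℚᵘ-homo-- : ∀ {p q p′ q′} → ℚ.toℚᵘ p ℚᵘ.≃ p′ → ℚ.toℚᵘ q ℚᵘ.≃ q′ → ℚ.toℚᵘ (p - q) ℚᵘ.≃ p′ ℚᵘ.- q′
  toℚᵘ-homo-- {p} {q} p≃ q≃ = ℚᵘ.≃-trans (ℚ.toℚᵘ-homo-+ p (ℚ.- q))
    (ℚᵘ.+-cong p≃ (ℚᵘ.≃-trans (ℚ.toℚᵘ-homo‿- q) (ℚᵘ.-‿cong q≃)))

  toℚᵘ-lhs : ℚ.toℚᵘ ((+ a) / 8 - (+ b) / 8 - (+ c) / 1)
    ℚᵘ.≃ ℚᵘ.mkℚᵘ (+ a) 7 ℚᵘ.- ℚᵘ.mkℚᵘ (+ b) 7 ℚᵘ.- ℚᵘ.mkℚᵘ (+ c) 0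
  toℚᵘ-lhs = toℚᵘ-homo-- {(+ a) / 8 - (+ b) / 8} {(+ c) / 1}
    (toℚᵘ-homo-- {(+ a) / 8} {(+ b) / 8} (toℚᵘ-/ a 7) (toℚᵘ-/ b 7)) (toℚᵘ-/ c 0)

  -- Unnormalised subtraction multiplies the denominators 8, 8 and 1, whence 64.
  numerators : ((+ a ℤ.* + 8 ℤ.+ (ℤ.- + b) ℤ.* + 8) ℤ.* + 1 ℤ.+ (ℤ.- + c) ℤ.* + 64) ℤ.* + 1
    ℤ.< + w ℤ.* + 64
  numerators = begin-strict
    ((+ a ℤ.* + 8 ℤ.+ (ℤ.- + b) ℤ.* + 8) ℤ.* + 1 ℤ.+ (ℤ.- + c) ℤ.* + 64) ℤ.* + 1
      ≡⟨ lhs (+ a) (+ b) (+ c) ⟩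
    (+ a ℤ.- (+ b ℤ.+ + 8 ℤ.* + c)) ℤ.* + 8
      <⟨ ℤ.*-monoʳ-<-pos (+ 8) (ℤ.+-monoˡ-< (ℤ.- (+ b ℤ.+ + 8 ℤ.* + c)) (ℤ.+<+ a<)) ⟩
    (+ (b + 8 * c + 8 * w) ℤ.- (+ b ℤ.+ + 8 ℤ.* + c)) ℤ.* + 8
      ≡⟨ cong (λ x → (x ℤ.- (+ b ℤ.+ + 8 ℤ.* + c)) ℤ.* + 8)
              (cong₂ (λ x y → + b ℤ.+ x ℤ.+ y) (ℤ.pos-* 8 c) (ℤ.pos-* 8 w)) ⟩
    (+ b ℤ.+ + 8 ℤ.* + c ℤ.+ + 8 ℤ.* + w ℤ.- (+ b ℤ.+ + 8 ℤ.* + c)) ℤ.* + 8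
      ≡⟨ rhs (+ b) (+ c) (+ w) ⟩
    + w ℤ.* + 64 ∎
    where
    open ℤ.≤-Reasoning
    lhs : ∀ a b c → ((a ℤ.* + 8 ℤ.+ (ℤ.- b) ℤ.* + 8) ℤ.* + 1 ℤ.+ (ℤ.- c) ℤ.* + 64) ℤ.* + 1
      ≡ (a ℤ.- (b ℤ.+ + 8 ℤ.* c)) ℤ.* + 8
    lhs = solveℤ-∀
    rhs : ∀ b c w → (b ℤ.+ + 8 ℤ.* c ℤ.+ + 8 ℤ.* w ℤ.- (b ℤ.+ + 8 ℤ.* c)) ℤ.* + 8 ≡ w ℤ.* + 64
    rhs = solveℤ-∀

-- From forks to the discrepancy bound

gridPath : ∀ n m (f : Labelling (P (suc n) □ P (suc m))) → ∃[ s ]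
  suc n * suc m ℕ.< suc n ⊔ suc m + 8 * (suc n ⊓ suc m) + 8 * s × HasPath {P (suc n) □ P (suc m)} f s
gridPath n m f with ℕ.≤-total m n
... | inj₁ m≤n rewrite ℕ.m≥n⇒m⊔n≡m m≤n | ℕ.m≥n⇒m⊓n≡n m≤n =
  _ , nm<n+8m+8s n m , fork⇒hasPath (proj₂ (snakeFork n m f))
-- The ladders are to run along the longer side, so here the path is built in the transposed grid
-- and carried back.
... | inj₂ n≤m rewrite ℕ.m≤n⇒m⊔n≡n n≤m | ℕ.m≤n⇒m⊓n≡m n≤m | ℕ.*-comm (suc n) (suc m) =
  _ , nm<n+8m+8s m n , push-hasPath transpose (fork⇒hasPath (proj₂ (snakeFork m n _)))

proposition1p6 : (k ℓ : ℕ) .{{_ : NonZero k}} .{{_ : NonZero ℓ}} →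
    let bound = (+ (k * ℓ)) / 8 - (+ (k ⊔ ℓ)) / 8 - (+ (k ⊓ ℓ)) / 1 in
    (∀ d → IsDiscrepancy (𝒫 (P k □ P ℓ)) d → bound < (+ d) / 1)
    × (∀ (f : Labelling (P k □ P ℓ)) →
    ∃[ Q ] bound < (+ ∣ weight f (pathSubgraph {P k □ P ℓ} Q) ∣) / 1)
proposition1p6 k@(suc n) ℓ@(suc m) =
    -- For a labelling attaining the minimum, `d` is its maximal absolute weight and so dominates
    -- the path found for it.
    (λ d ((f , _ , w≤d) , _) →
      let (Q , bound<w) = exceeding f in ℚ.<-≤-trans bound<w (n/1-mono (w≤d Q)))
  , exceeding
  where
  exceeding : ∀ f → ∃[ Q ] (+ (k * ℓ)) / 8 - (+ (k ⊔ ℓ)) / 8 - (+ (k ⊓ ℓ)) / 1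
                         < (+ ∣ weight f (pathSubgraph {P k □ P ℓ} Q) ∣) / 1
  exceeding f =
    let (s , kℓ< , path) = gridPath n m f
        (Q , s≤w)        = hasPath⇒path path
    in Q , a/8-b/8-c<w (k * ℓ) (k ⊔ ℓ) (k ⊓ ℓ) ∣ weight f (pathSubgraph {P k □ P ℓ} Q) ∣
             (ℕ.<-≤-trans kℓ< (ℕ.+-monoʳ-≤ (k ⊔ ℓ + 8 * (k ⊓ ℓ)) (ℕ.*-monoʳ-≤ 8 s≤w)))

  n/1-mono : ∀ {x y} → x ≤ y → (+ x) / 1 ℚ.≤ (+ y) / 1
  n/1-mono {x} {y} x≤y = ℚ.toℚᵘ-cancel-≤
    (ℚᵘ.≤-respˡ-≃ (ℚᵘ.≃-sym (ℚ.toℚᵘ-fromℚᵘ (ℚᵘ.mkℚᵘ (+ x) 0)))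
    (ℚᵘ.≤-respʳ-≃ (ℚᵘ.≃-sym (ℚ.toℚᵘ-fromℚᵘ (ℚᵘ.mkℚᵘ (+ y) 0)))
    (ℚᵘ.*≤* (ℤ.*-monoʳ-≤-nonNeg (+ 1) (ℤ.+≤+ x≤y)))))
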